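{- Let $\mathbf P=(P,\leq)$ be a partially ordered set with maximum $1$. (1) If the Frattini element $\Phi$ of $\mathbf P$ exists and is locally $1$-compact, or just very-weakly-locally-$1$-compact, then $\Phi$ is the join of all the non-generators of $\mathbf P$. (2) In particular, if $\mathbf P$ is a complete $1$-algebraic lattice, or just a complete very-weakly-$1$-algebraic lattice, then $\Phi$ is the join of all the non-generators of $\mathbf P$. (3) If $\mathbf P$ is a very-weakly-$1$-algebraic poset, then $\Phi$ exists if and only if the join of all the non-generators exists and, if this is the case, they coincide. (4) If $\mathbf P$ is a finite join-semilattice and there exists at least one non-generator, then $\Phi$ exists and is the join of all the non-generators.
   Context: Let $\mathbf P=(P,\leq)$ be a poset with maximum $1$ (not assumed to be a semilattice unless stated). For $a,e \in P$, "$a \vee e = 1$" means that there is no $p \in P$ such that $p<1$, $a \leq p$ and $e \leq p$. For $X\subseteq P$, "$\bigvee X=1$" means that there is no $p\in P$ such that $p<1$ and $x\leq p$ for every $x\in X$. Otherwise, join and meet mean least upper bound and greatest lower bound in $\mathbf P$, when they exist. An element $a\in P$ is a non-generator if, for every $e \in P$, $a\vee e=1$ implies $e=1$. An element $p\in P$ is maximal$_{<1}$ if $p<1$ and there is no $q \in P$ such that $p<q<1$. An element $e\in P$ can be extended to a maximal$_{<1}$ element if there is a maximal$_{<1}$ element $p$ with $e \leq p$. If the meet of all the maximal$_{<1}$ elements of $\mathbf P$ exists, it is denoted by $\Phi$ and called the Frattini element of $\mathbf P$. If $\mathbf P$ has no maximal$_{<1}$ element, we set $\Phi=1$. A chain is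 a nonempty subset that is linearly ordered by the induced order; chains are denoted as families $(e_i)_{i\in I}$. An element $a$ is $1$-compact if, whenever $(e_i)_{i\in I}$ is a chain of elements of $P$ and $\bigvee_{i\in I}e_i=1$, then $a\leq e_i$ for some $i \in I$. An element $a$ is very-weakly-$1$-compact if, whenever $(e_i)_{i\in I}$ is a chain of elements of $P$ with $e_i<1$ for every $i\in I$, $\bigvee_{i\in I}e_i=1$, and no $e_i$ can be extended to a maximal$_{<1}$ element, then there are some $i\in I$ and some $r\in P$ such that $r<1$, $e_i\leq r$ and $a\leq r$. An element $b$ of $\mathbf P$ is locally $1$-compact (respectively, very-weakly-locally-$1$-compact) if $b$ can be expressed as the join of a family of $1$-compact (respectively, very-weakly-$1$-compact) elements. The poset $\mathbf P$ is $1$-algebraic (respectively, very-weakly-$1$-algebraic) if every element of $P$ is locally $1$-compact (respectively, very-weakly-locally-$1$-compact). -}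

module Defs where

open import Data.Fin.Base using (Fin)
open import Data.Nat.Base using (ℕ)
open import Data.Product.Base using (Σ; ∃; _×_)
open import Data.Sum.Base using (_⊎_)
open import Function.Bundles using (Bijection)
open import Level using (Level; _⊔_; suc)
open import Relation.Binary.Bundles using (Poset)
import Relation.Binary.Properties.Poset as PosetProperties
open import Relation.Binary.PropositionalEquality.Properties using (setoid)
open import Relation.Nullary.Negation.Core using (¬_)
open import Relation.Unary using (Pred; _⊆_; Satisfiable)

-- 𝟙 is the maximum of P; that it is one is assumed where the notions are used,
-- as none of the definitions depends on it.

module Frattini {c ℓ₁ ℓ₂ : Level} (P : Poset c ℓ₁ ℓ₂) (𝟙 : Poset.Carrier P) where

  open Poset P using (Carrier; _≈_; _≤_; module Eq)
  open PosetProperties P using (_<_)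

  -- Subsets, and hence families up to repetition, are predicates at the least
  -- level that accommodates the sets of maximal elements and of non-generators.
  -- Under excluded middle every predicate, at any level, is equivalent to one
  -- at this level, so no subset is lost.

  Subset : Set (suc (c ⊔ ℓ₁ ⊔ ℓ₂))
  Subset = Pred Carrier (c ⊔ ℓ₁ ⊔ ℓ₂)

  IsUpperBound : Subset → Carrier → Set (c ⊔ ℓ₁ ⊔ ℓ₂)
  IsUpperBound X b = ∀ {x} → X x → x ≤ b

  IsLowerBound : Subset → Carrier → Set (c ⊔ ℓ₁ ⊔ ℓ₂)
  IsLowerBound X b = ∀ {x} → X x → b ≤ x

  IsJoin : Subset → Carrier → Set (c ⊔ ℓ₁ ⊔ ℓ₂)
  IsJoin X b = IsUpperBound X b × (∀ u → IsUpperBound X u → b ≤ u)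

  IsMeet : Subset → Carrier → Set (c ⊔ ℓ₁ ⊔ ℓ₂)
  IsMeet X b = IsLowerBound X b × (∀ l → IsLowerBound X l → l ≤ b)

  -- The notations "a ∨ e = 1" and "⋁ X = 1", which do not mean that 1 is the
  -- least upper bound.

  _∨_≡𝟙 : Carrier → Carrier → Set (c ⊔ ℓ₁ ⊔ ℓ₂)
  a ∨ e ≡𝟙 = ¬ (∃ λ p → p < 𝟙 × a ≤ p × e ≤ p)

  ⋁_≡𝟙 : Subset → Set (c ⊔ ℓ₁ ⊔ ℓ₂)
  ⋁ X ≡𝟙 = ¬ (∃ λ p → p < 𝟙 × IsUpperBound X p)

  NonGenerator : Subset
  NonGenerator a = ∀ e → a ∨ e ≡𝟙 → e ≈ 𝟙

  Maximal<𝟙 : Subset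
  Maximal<𝟙 p = p < 𝟙 × ¬ (∃ λ q → p < q × q < 𝟙)

  ExtendsToMaximal : Subset
  ExtendsToMaximal e = ∃ λ p → Maximal<𝟙 p × e ≤ p

  IsFrattini : Carrier → Set (c ⊔ ℓ₁ ⊔ ℓ₂)
  IsFrattini φ = (Satisfiable Maximal<𝟙 → IsMeet Maximal<𝟙 φ)
               × (¬ Satisfiable Maximal<𝟙 → φ ≈ 𝟙)

  IsChain : Subset → Set (c ⊔ ℓ₁ ⊔ ℓ₂)
  IsChain E = Satisfiable E × (∀ {x y} → E x → E y → x ≤ y ⊎ y ≤ x)

  OneCompact : Carrier → Set (suc (c ⊔ ℓ₁ ⊔ ℓ₂))
  OneCompact a = ∀ (E : Subset) → IsChain E → ⋁ E ≡𝟙 → ∃ λ e → E e × a ≤ e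

  VeryWeaklyOneCompact : Carrier → Set (suc (c ⊔ ℓ₁ ⊔ ℓ₂))
  VeryWeaklyOneCompact a =
    ∀ (E : Subset) → IsChain E →
    (∀ {e} → E e → e < 𝟙) →
    ⋁ E ≡𝟙 →
    (∀ {e} → E e → ¬ ExtendsToMaximal e) →
    ∃ λ e → E e × (∃ λ r → r < 𝟙 × e ≤ r × a ≤ r)

  LocallyOneCompact : Carrier → Set (suc (c ⊔ ℓ₁ ⊔ ℓ₂))
  LocallyOneCompact b = Σ Subset λ X → X ⊆ OneCompact × IsJoin X b

  VeryWeaklyLocallyOneCompact : Carrier → Set (suc (c ⊔ ℓ₁ ⊔ ℓ₂))
  VeryWeaklyLocallyOneCompact b = Σ Subset λ X → X ⊆ VeryWeaklyOneCompact × IsJoin X b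

  OneAlgebraic : Set (suc (c ⊔ ℓ₁ ⊔ ℓ₂))
  OneAlgebraic = ∀ b → LocallyOneCompact b

  VeryWeaklyOneAlgebraic : Set (suc (c ⊔ ℓ₁ ⊔ ℓ₂))
  VeryWeaklyOneAlgebraic = ∀ b → VeryWeaklyLocallyOneCompact b

  IsCompleteLattice : Set (suc (c ⊔ ℓ₁ ⊔ ℓ₂))
  IsCompleteLattice = ∀ (X : Subset) → ∃ (IsJoin X) × ∃ (IsMeet X)

  IsFinite : Set (c ⊔ ℓ₁)
  IsFinite = ∃ λ (n : ℕ) → Bijection (setoid (Fin n)) Eq.setoid

{-# OPTIONS --safe #-}

-- The heart of the matter is that a very-weakly-1-compact element a below all
-- maximal elements is a non-generator.  If a ∨ e = 1 with e < 1, then e extends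
-- to no maximal element, so a chain in [e , 1) without strict upper bound in
-- [e , 1) has no upper bound below 1 at all, and compactness of a yields r < 1
-- above both a and e.  Such a chain arises by choosing strict upper bounds
-- transfinitely, as in the proof of Zorn's lemma.  Conversely, non-generators
-- lie below every maximal element.  Finite posets are 1-algebraic, and in a
-- join-semilattice the non-generators are closed under joins, so if there are
-- finitely many of them and at least one, they have a greatest element.

module Submission where

open import Defs
open import Algebra.Core using (Op₂)
open import Axiom.ExcludedMiddle using (ExcludedMiddle)
open import Axiom.Extensionality.Propositional using (Extensionality)
open import Data.Bool.Base using (Bool; false; T)
open import Data.Fin.Base using (Fin; zero; suc)
open import Data.Nat.Base using (zero; suc)
open import Data.Product.Base using (∃; _×_; _,_; proj₁; proj₂)
open import Data.Sum.Base using (_⊎_; inj₁; inj₂; [_,_]′)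
open import Function.Base using (_∘_; id)
open import Function.Bundles using (_⇔_; mk⇔; Bijection)
open import Level using (Lift; lift; lower; _⊔_)
open import Relation.Binary.Bundles using (Poset)
open import Relation.Binary.Definitions using (Maximum)
open import Relation.Binary.Lattice.Structures using (IsJoinSemilattice)
import Relation.Binary.Construct.NonStrictToStrict as NonStrictToStrict
import Relation.Binary.Properties.Poset as PosetProperties
open import Relation.Binary.PropositionalEquality.Core as ≡ using (_≡_; refl; cong)
open import Relation.Nullary.Decidable
  using (yes; no; isYes; isYes≗does; does-⇔; toWitness; fromWitness; decidable-stable)
open import Relation.Nullary.Negation.Core using (¬_; contradiction)
open import Relation.Unary using (Pred; _⊆_; Satisfiable)

-- Transfinite construction of a chain.

module UnboundedChain
  (em : ∀ {a} → ExcludedMiddle a) (ext : ∀ {a b} → Extensionality a b)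
  {c ℓ₁ ℓ₂ q} (P : Poset c ℓ₁ ℓ₂)
  (Q : Pred (Poset.Carrier P) q) (Q-inhabited : Satisfiable Q) where

  open Poset P using (Carrier; _≈_; _≤_; reflexive; trans; antisym; ≤-respˡ-≈; module Eq)
  open PosetProperties P using (_<_; <-irrefl)
  open NonStrictToStrict _≈_ _≤_ using (≤-<-trans)

  StrictBound : ∀ {a} → Pred Carrier a → Pred Carrier (a ⊔ c ⊔ ℓ₁ ⊔ ℓ₂ ⊔ q)
  StrictBound X u = Q u × (∀ {x} → X x → x < u)

  private
    -- Coding subsets as Boolean functions makes equivalent predicates equal by extensionality, so
    -- `choose` treats them alike, and lets `Tower` quantify over subsets without rising in level.
    decide : ∀ {a} → Pred Carrier a → Carrier → Bool
    decide X x = isYes (em {P = X x})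

    choose : (Carrier → Bool) → Carrier
    choose V with em {P = Satisfiable (T ∘ V)}
    ... | yes (x , _) = x
    ... | no _        = proj₁ Q-inhabited

    choose-∈ : ∀ V → Satisfiable (T ∘ V) → T (V (choose V))
    choose-∈ V V-inhabited with em {P = Satisfiable (T ∘ V)}
    ... | yes (_ , x∈V) = x∈V
    ... | no V-empty    = contradiction V-inhabited V-empty

    -- next A depends on A only through its strict bounds, so cofinal subsets
    -- have the same successor.

    next : (Carrier → Bool) → Carrier
    next A = choose (decide (StrictBound (T ∘ A)))

    next-strict : ∀ A → Satisfiable (StrictBound (T ∘ A)) → StrictBound (T ∘ A) (next A)
    next-strict A (u , u-strict) =
      toWitness (choose-∈ (decide (StrictBound (T ∘ A))) (u , fromWitness u-strict))

    next-cong : ∀ {A B} →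
                StrictBound (T ∘ A) ⊆ StrictBound (T ∘ B) →
                StrictBound (T ∘ B) ⊆ StrictBound (T ∘ A) →
                next A ≡ next B
    next-cong A⊆B B⊆A = cong choose (ext λ _ →
      ≡.trans (isYes≗does em) (≡.trans (does-⇔ (mk⇔ A⊆B B⊆A) em em) (≡.sym (isYes≗does em))))

  -- A transfinite iteration of `next` without ordinals: `A` can be any subset of the tower with a
  -- strict bound in `Q`, not only an initial segment.
  data Tower : Pred Carrier (c ⊔ ℓ₁ ⊔ ℓ₂ ⊔ q) where
    above : ∀ A → (∀ x → T (A x) → Tower x) → Satisfiable (StrictBound (T ∘ A)) →
            Tower (next A)

  Tower⊆Q : Tower ⊆ Q
  Tower⊆Q (above A _ bounded) = proj₁ (next-strict A bounded)

  Base : ∀ {x} → Tower x → Pred Carrier _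
  Base (above A _ _) = T ∘ A

  Base-< : ∀ {x y} (y∈T : Tower y) → Base y∈T x → x < y
  Base-< (above A _ bounded) = proj₂ (next-strict A bounded)

  -- The first alternative says more than `x < y`: its witness in the base is what yields cofinality
  -- in `compare-step`.
  Comparison : ∀ {y} → Carrier → Tower y → Set _
  Comparison {y} x y∈T = (∃ λ b → Base y∈T b × x ≤ b) ⊎ y ≤ x

  -- If x is below no element of the base of y, nor y below one of the base of
  -- x, then the hypotheses make the two bases cofinal in each other, so x ≡ y.

  compare-step : ∀ {x y} (x∈T : Tower x) (y∈T : Tower y) →
    (∀ {a} → Base x∈T a → Comparison a y∈T) →
    (∀ {b} → Base y∈T b → Comparison b x∈T) →
    Comparison x y∈T
  compare-step {x} {y} x∈T@(above A _ _) y∈T@(above B _ _) compareA compareB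
    with em {P = ∃ λ b → T (B b) × x ≤ b} | em {P = ∃ λ a → T (A a) × y ≤ a}
  ... | yes x≤B | _                   = inj₁ x≤B
  ... | no _    | yes (a , a∈A , y≤a) = inj₂ (trans y≤a (proj₁ (Base-< x∈T a∈A)))
  ... | no x≰B  | no y≰A              =
    inj₂ (reflexive (Eq.reflexive (next-cong strictB⊆strictA strictA⊆strictB)))
    where
    strictB⊆strictA : StrictBound (T ∘ B) ⊆ StrictBound (T ∘ A)
    strictB⊆strictA (u∈Q , B<u) = u∈Q , λ {a} a∈A →
      [ (λ (b , b∈B , a≤b) → ≤-<-trans trans antisym ≤-respˡ-≈ a≤b (B<u b∈B))
      , (λ y≤a → contradiction (a , a∈A , y≤a) y≰A)
      ]′ (compareA a∈A)

    strictA⊆strictB : StrictBound (T ∘ A) ⊆ StrictBound (T ∘ B)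
    strictA⊆strictB (u∈Q , A<u) = u∈Q , λ {b} b∈B →
      [ (λ (a , a∈A , b≤a) → ≤-<-trans trans antisym ≤-respˡ-≈ b≤a (A<u a∈A))
      , (λ x≤b → contradiction (b , b∈B , x≤b) x≰B)
      ]′ (compareB b∈B)

  -- Induction on both derivations at once: the second call swaps their roles, but each call shrinks
  -- one and keeps the other.
  compare : ∀ {x y} → Tower x → (y∈T : Tower y) → Comparison x y∈T
  compare x∈T@(above _ A⊆T _) y∈T@(above _ B⊆T _) = compare-step x∈T y∈T
    (λ a∈A → compare (A⊆T _ a∈A) y∈T)
    (λ b∈B → compare (B⊆T _ b∈B) x∈T)

  Tower-isChain : ∀ {x y} → Tower x → Tower y → x ≤ y ⊎ y ≤ x
  Tower-isChain x∈T y∈T with compare x∈T y∈T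
  ... | inj₁ (_ , b∈B , x≤b) = inj₁ (trans x≤b (proj₁ (Base-< y∈T b∈B)))
  ... | inj₂ y≤x             = inj₂ y≤x

  -- Otherwise the successor of the whole tower would lie in the tower.

  Tower-unbounded : ¬ Satisfiable (StrictBound Tower)
  Tower-unbounded (u , u∈Q , T<u) = <-irrefl Eq.refl (Base-< top∈T (fromWitness top∈T))
    where
    top∈T : Tower (next (decide Tower))
    top∈T = above (decide Tower) (λ _ → toWitness) (u , u∈Q , λ x∈T → T<u (toWitness x∈T))

  Tower-inhabited : Satisfiable Tower
  -- Every element of `Q` strictly bounds the empty set, which gives a first stage.
  Tower-inhabited = _ , above (λ _ → false) (λ _ ()) (proj₁ Q-inhabited , proj₂ Q-inhabited , λ ())

-- Non-generators and maximal elements.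

module NonGenerators
  (em : ∀ {a} → ExcludedMiddle a) (ext : ∀ {a b} → Extensionality a b)
  {c ℓ₁ ℓ₂} (P : Poset c ℓ₁ ℓ₂) (𝟙 : Poset.Carrier P)
  (maximum : Maximum (Poset._≤_ P) 𝟙) where

  open Poset P renaming (refl to ≤-refl)
  open PosetProperties P using (_<_; <⇒≱)
  open NonStrictToStrict _≈_ _≤_ using (≤-<-trans)
  open Frattini P 𝟙

  ≮𝟙⇒≈𝟙 : ∀ {x} → ¬ (x < 𝟙) → x ≈ 𝟙
  ≮𝟙⇒≈𝟙 x≮𝟙 = decidable-stable em λ x≉𝟙 → x≮𝟙 (maximum _ , x≉𝟙)

  isJoin-unique : ∀ {X b b′} → IsJoin X b → IsJoin X b′ → b ≈ b′
  isJoin-unique (X≤b , b-least) (X≤b′ , b′-least) = antisym (b-least _ X≤b′) (b′-least _ X≤b)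

  -- The value `𝟙` prescribed in the absence of maximal elements is the empty meet.
  isFrattini⇒isMeet : ∀ {φ} → IsFrattini φ → IsMeet Maximal<𝟙 φ
  isFrattini⇒isMeet (meet , top) with em {P = Satisfiable Maximal<𝟙}
  ... | yes some = meet some
  ... | no none  = (λ {p} p-max → contradiction (p , p-max) none)
                 , λ l _ → trans (maximum l) (reflexive (Eq.sym (top none)))

  isMeet⇒isFrattini : ∀ {φ} → IsMeet Maximal<𝟙 φ → IsFrattini φ
  isMeet⇒isFrattini meet@(_ , greatest) =
    (λ _ → meet) ,
    λ none → antisym (maximum _) (greatest 𝟙 λ {p} p-max → contradiction (p , p-max) none)

  -- If `a ≰ p`, a common upper bound below `𝟙` would lie strictly above `p`, against maximality. So
  -- `a ∨ p ≡𝟙`, which forces `p ≈ 𝟙`.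
  nonGenerator⇒≤maximal : ∀ {a} → NonGenerator a → IsLowerBound Maximal<𝟙 a
  nonGenerator⇒≤maximal a-ng {p} ((_ , p≉𝟙) , p-max) = decidable-stable em λ a≰p →
    p≉𝟙 (a-ng p λ (q , q<𝟙 , a≤q , p≤q) →
      p-max (q , (p≤q , λ p≈q → a≰p (trans a≤q (reflexive (Eq.sym p≈q)))) , q<𝟙))

  -- The tower grows between `e` and `𝟙`. An upper bound `p < 𝟙` of it would be a maximal element
  -- above `e`, since any `q` strictly between `p` and `𝟙` would strictly bound the tower.
  unextendable⇒chain : ∀ {e} → e < 𝟙 → ¬ ExtendsToMaximal e →
    ∃ λ E → IsChain E × (∀ {x} → E x → e ≤ x × x < 𝟙) × ⋁ E ≡𝟙
  unextendable⇒chain {e} e<𝟙 e-unext =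
    Tower , (Tower-inhabited , Tower-isChain) , Tower⊆Q , λ (p , p<𝟙 , T≤p) →
      let (x , x∈T) = Tower-inhabited
          e≤p       = trans (proj₁ (Tower⊆Q x∈T)) (T≤p x∈T)
      in e-unext (p , (p<𝟙 , λ (q , p<q , q<𝟙) →
           Tower-unbounded (q , (trans e≤p (proj₁ p<q) , q<𝟙) ,
                            λ y∈T → ≤-<-trans trans antisym ≤-respˡ-≈ (T≤p y∈T) p<q)) , e≤p)
    where
    open UnboundedChain em ext P (λ x → e ≤ x × x < 𝟙) (e , ≤-refl , e<𝟙)

  ≤maximal⇒nonGenerator : ∀ {a} → VeryWeaklyOneCompact a → IsLowerBound Maximal<𝟙 a →
                          NonGenerator a
  ≤maximal⇒nonGenerator {a} a-compact a≤max e a∨e≡𝟙 = ≮𝟙⇒≈𝟙 λ e<𝟙 →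
    let e-unext : ¬ ExtendsToMaximal e
        e-unext (p , p-max , e≤p) = a∨e≡𝟙 (p , proj₁ p-max , a≤max p-max , e≤p)
        (E , E-chain , e≤E<𝟙 , ⋁E≡𝟙) = unextendable⇒chain e<𝟙 e-unext
        (x , x∈E , r , r<𝟙 , x≤r , a≤r) =
          a-compact E E-chain (proj₂ ∘ e≤E<𝟙) ⋁E≡𝟙 λ x∈E (p , p-max , x≤p) →
            e-unext (p , p-max , trans (proj₁ (e≤E<𝟙 x∈E)) x≤p)
    in a∨e≡𝟙 (r , r<𝟙 , a≤r , trans (proj₁ (e≤E<𝟙 x∈E)) x≤r)

  oneCompact⇒veryWeakly : OneCompact ⊆ VeryWeaklyOneCompact
  oneCompact⇒veryWeakly a-compact E E-chain E<𝟙 ⋁E≡𝟙 _ =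
    let (e , e∈E , a≤e) = a-compact E E-chain ⋁E≡𝟙
    in e , e∈E , e , E<𝟙 e∈E , ≤-refl , a≤e

  locally⇒veryWeakly : LocallyOneCompact ⊆ VeryWeaklyLocallyOneCompact
  locally⇒veryWeakly (X , X-compact , join) = X , oneCompact⇒veryWeakly ∘ X-compact , join

  -- The compact elements whose join is `l` are below every maximal element, hence non-generators,
  -- hence below `u`. This serves both directions: `l` is the Frattini element in one, `u` the join
  -- in the other.
  lowerBound≤upperBound : ∀ {l u} → VeryWeaklyLocallyOneCompact l →
    IsLowerBound Maximal<𝟙 l → IsUpperBound NonGenerator u → l ≤ u
  lowerBound≤upperBound (X , X-compact , X≤l , l-least) l≤max NG≤u =
    l-least _ λ x∈X → NG≤u (≤maximal⇒nonGenerator (X-compact x∈X) (trans (X≤l x∈X) ∘ l≤max))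

  frattini-isJoin : ∀ {φ} → IsFrattini φ → VeryWeaklyLocallyOneCompact φ → IsJoin NonGenerator φ
  frattini-isJoin φ-frattini φ-compact =
    let (φ≤max , greatest) = isFrattini⇒isMeet φ-frattini
    in (λ a-ng → greatest _ (nonGenerator⇒≤maximal a-ng)) ,
       λ u → lowerBound≤upperBound φ-compact φ≤max

  join-isFrattini : VeryWeaklyOneAlgebraic → ∀ {j} → IsJoin NonGenerator j → IsFrattini j
  join-isFrattini algebraic (NG≤j , j-least) = isMeet⇒isFrattini
    ( (λ p-max → j-least _ λ a-ng → nonGenerator⇒≤maximal a-ng p-max)
    , λ l l≤max → lowerBound≤upperBound (algebraic l) l≤max NG≤j )

  -- Finite posets and join-semilattices.

  Directed : Subset → Set _
  Directed X = ∀ {x y} → X x → X y → ∃ λ z → X z × x ≤ z × y ≤ z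

  -- Induction on the length of the list `f`, skipping entries that match no member of `X`. Matching
  -- is up to `≈` because `X` need not respect `≈`.
  directed⇒upperBound-∈ : ∀ {X} → Directed X → Satisfiable X → ∀ n (f : Fin n → Carrier) →
    ∃ λ m → X m × (∀ i {x} → X x → f i ≈ x → x ≤ m)
  directed⇒upperBound-∈ dir (x , x∈X) zero f = x , x∈X , λ ()
  directed⇒upperBound-∈ {X} dir X-inhabited (suc n) f
    with directed⇒upperBound-∈ dir X-inhabited n (f ∘ suc)
       | em {P = ∃ λ x → X x × f zero ≈ x}
  ... | m , m∈X , m-bound | no none =
    m , m∈X , λ { zero x∈X f0≈x → contradiction (_ , x∈X , f0≈x) none ; (suc i) → m-bound i }
  ... | m , m∈X , m-bound | yes (x , x∈X , f0≈x) =
    let (z , z∈X , x≤z , m≤z) = dir x∈X m∈X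
    in z , z∈X , λ { zero    _   f0≈y → trans (reflexive (Eq.trans (Eq.sym f0≈y) f0≈x)) x≤z
                   ; (suc i) y∈X fi≈y → trans (m-bound i y∈X fi≈y) m≤z }

  finite∧directed⇒greatest : IsFinite → ∀ {X} → Directed X → Satisfiable X →
    ∃ λ m → X m × IsUpperBound X m
  finite∧directed⇒greatest (n , enum) dir X-inhabited =
    let open Bijection enum
        (m , m∈X , m-bound) = directed⇒upperBound-∈ dir X-inhabited n to
    in m , m∈X , λ {x} x∈X →
      let (i , i↦x) = surjective x in m-bound i x∈X (i↦x refl)

  -- The greatest member of a finite chain bounds it, so it cannot be below `𝟙`; it is then `𝟙` and
  -- dominates `a`.
  finite⇒oneCompact : IsFinite → ∀ a → OneCompact a
  finite⇒oneCompact finite a E (E-inhabited , E-total) ⋁E≡𝟙 =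
    let (m , m∈E , E≤m) = finite∧directed⇒greatest finite E-directed E-inhabited
        m≈𝟙             = ≮𝟙⇒≈𝟙 λ m<𝟙 → ⋁E≡𝟙 (m , m<𝟙 , E≤m)
    in m , m∈E , trans (maximum a) (reflexive (Eq.sym m≈𝟙))
    where
    E-directed : Directed E
    E-directed {x} {y} x∈E y∈E =
      [ (λ x≤y → y , y∈E , x≤y , ≤-refl) , (λ y≤x → x , x∈E , ≤-refl , y≤x) ]′ (E-total x∈E y∈E)

  finite⇒oneAlgebraic : IsFinite → OneAlgebraic
  finite⇒oneAlgebraic finite b =
    (λ x → Lift (c ⊔ ℓ₁ ⊔ ℓ₂) (x ≈ b)) , (λ {x} _ → finite⇒oneCompact finite x) ,
    (reflexive ∘ lower) , λ u b≤u → b≤u (lift Eq.refl)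

  -- By associativity, a bound below `𝟙` for `a` and `b ∨ e` would also bound `a ∨ b` and `e`. So
  -- `a` can be discarded, and then `b`.
  nonGenerator-directed : ∀ {_∨_} → IsJoinSemilattice _≈_ _≤_ _∨_ → Directed NonGenerator
  nonGenerator-directed {_∨_} isJoinSemilattice {a} {b} a-ng b-ng =
    a ∨ b , a∨b-ng , x≤x∨y a b , y≤x∨y a b
    where
    open IsJoinSemilattice isJoinSemilattice using (x≤x∨y; y≤x∨y; ∨-least)

    a∨b-ng : NonGenerator (a ∨ b)
    a∨b-ng e a∨b∨e≡𝟙 = b-ng e λ (p , p<𝟙 , b≤p , e≤p) →
      <⇒≱ p<𝟙 (trans (reflexive (Eq.sym b∨e≈𝟙)) (∨-least b≤p e≤p))
      where
      b∨e≈𝟙 : b ∨ e ≈ 𝟙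
      b∨e≈𝟙 = a-ng (b ∨ e) λ (p , p<𝟙 , a≤p , b∨e≤p) →
        a∨b∨e≡𝟙 (p , p<𝟙 , ∨-least a≤p (trans (x≤x∨y b e) b∨e≤p) , trans (y≤x∨y b e) b∨e≤p)

corollary2p6 :
  (∀ {a} → ExcludedMiddle a) →
  (∀ {a b} → Extensionality a b) →
  ∀ {c ℓ₁ ℓ₂} (P : Poset c ℓ₁ ℓ₂) (𝟙 : Poset.Carrier P) →
  Maximum (Poset._≤_ P) 𝟙 →
  let open Poset P
      open Frattini P 𝟙
  in
    (∀ φ → IsFrattini φ →
       LocallyOneCompact φ ⊎ VeryWeaklyLocallyOneCompact φ →
       IsJoin NonGenerator φ)
  × (IsCompleteLattice → OneAlgebraic ⊎ VeryWeaklyOneAlgebraic →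
       ∃ λ φ → IsFrattini φ × IsJoin NonGenerator φ)
  × (VeryWeaklyOneAlgebraic →
       (∃ IsFrattini ⇔ ∃ (IsJoin NonGenerator))
     × (∀ φ j → IsFrattini φ → IsJoin NonGenerator j → φ ≈ j))
  × ((_∨_ : Op₂ Carrier) → IsJoinSemilattice _≈_ _≤_ _∨_ → IsFinite →
       ∃ NonGenerator →
       ∃ λ φ → IsFrattini φ × IsJoin NonGenerator φ)
corollary2p6 em ext P 𝟙 maximum =
    (λ φ φ-frattini φ-compact → frattini-isJoin φ-frattini ([ locally⇒veryWeakly , id ]′ φ-compact))
  , (λ complete algebraic →
       let (φ , φ-meet) = proj₂ (complete Maximal<𝟙)
           φ-frattini   = isMeet⇒isFrattini φ-meet
       in φ , φ-frattini , frattini-isJoin φ-frattini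
            ([ (λ alg → locally⇒veryWeakly (alg φ)) , (λ alg → alg φ) ]′ algebraic))
  , (λ algebraic →
         mk⇔ (λ (φ , φ-frattini) → φ , frattini-isJoin φ-frattini (algebraic φ))
             (λ (j , j-join) → j , join-isFrattini algebraic j-join)
       , λ φ j φ-frattini → isJoin-unique (frattini-isJoin φ-frattini (algebraic φ)))
  , λ _∨_ isJoinSemilattice finite inhabited →
      let (j , j-ng , NG≤j) = finite∧directed⇒greatest finite
                                (nonGenerator-directed isJoinSemilattice) inhabited
          j-join = (λ {x} → NG≤j {x}) , λ u NG≤u → NG≤u j-ng
      in j , join-isFrattini (λ b → locally⇒veryWeakly (finite⇒oneAlgebraic finite b)) j-join , j-join
  where
  open Frattini P 𝟙
  open NonGenerators em ext P 𝟙 maximum
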